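{- Every connected graph $G$ has the following properties: (1) $G$ is a prism $\gamma_{con}$-fixer, i.e. $\gamma_{con}(\mathrm{Id}\,G)=\gamma_{con}(G)$, if and only if $\gamma_{con}(G)=|V_G|$; (2) $G$ is a prism $\gamma_{con}$-doubler, i.e. $\gamma_{con}(\mathrm{Id}\,G)=2\gamma_{con}(G)$, if and only if $\gamma_{con}(G)\le\frac12|V_G|$.
   Context: Graphs are finite, simple, undirected and nonempty. For a graph $G$ with vertex set $V_G$ and a permutation $\pi$ of $V_G$, let $G'$ be a vertex-disjoint copy of $G$, with $v'$ the copy of $v$. The prism graph $\pi G$ has vertex set $V\cup V'$, where $V=V_G$ and $V'=V_{G'}$, and edge set $E_G\cup E_{G'}\cup\{u\,\pi(u)':u\in V_G\}$. $\mathrm{Id}\,G$ is the prism graph for $\pi$ the identity permutation. A set $A$ of vertices is dominating if every vertex of the graph is in $A$ or adjacent to a vertex of $A$. In a connected graph, $A$ is convex if for every $u,v\in A$ it contains all vertices of every shortest $u$--$v$ path of the graph. $\gamma_{con}$ denotes the minimum cardinality of a convex dominating set. A graph $G$ is a prism $\gamma_{con}$-fixer if $\gamma_{con}(\mathrm{Id}\,G)=\gamma_{con}(G)$, and a prism $\gamma_{con}$-doubler if $\gamma_{con}(\mathrm{Id}\,G)=2\gamma_{con}(G)$. -}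

module Defs where

open import Data.Empty using (⊥-elim)
open import Data.Fin using (Fin; zero; suc; splitAt)
open import Data.Fin.Permutation as Perm using (Permutation′; _⟨$⟩ʳ_)
open import Data.Fin.Properties using (any?; all?; injective⇒≤) renaming (_≟_ to _≟ᶠ_)
open import Data.Fin.Subset using (Subset; _∈_; ∣_∣; ⊤)
open import Data.Fin.Subset.Properties using (_∈?_; anySubset?; ∈⊤; ∣⊤∣≡n)
open import Data.List using (List; []; _∷_; head; last; length; lookup)
open import Data.List.Relation.Unary.All as All using (All; []; _∷_)
open import Data.List.Relation.Unary.AllPairs using ([]; _∷_)
open import Data.List.Relation.Unary.Linked using (Linked; linked?)
open import Data.List.Relation.Unary.Unique.Propositional using (Unique)
open import Data.List.Relation.Unary.Unique.DecPropositional using (unique?)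
open import Data.Maybe using (just)
open import Data.Maybe.Properties using (≡-dec)
open import Data.Nat using (ℕ; zero; suc; NonZero; _+_; _*_; _≤_; z≤n; s≤s; _≤?_)
open import Data.Nat.Properties using () renaming (_≟_ to _≟ⁿ_)
open import Data.Product using (∃; _×_; _,_; proj₁; proj₂)
open import Data.Sum using (_⊎_; inj₁; inj₂)
open import Function using (Injective; _∘_)
open import Level using (0ℓ)
open import Relation.Binary using (Rel; Symmetric; Irreflexive) renaming (Decidable to Decidable₂)
open import Relation.Binary.PropositionalEquality using (_≡_; refl; sym; cong)
open import Relation.Nullary using (¬_; Dec; yes; no; ¬?)
open import Relation.Nullary.Decidable using (map′; _×-dec_; _⊎-dec_; _→-dec_; decidable-stable)
open import Relation.Unary using (Pred; Decidable)

record Graph : Set₁ where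
  field
    order    : ℕ
    nonEmpty : NonZero order

  V : Set
  V = Fin order

  field
    Adj    : Rel V 0ℓ
    adj?   : Decidable₂ Adj
    symm   : Symmetric Adj
    irrefl : Irreflexive _≡_ Adj

open Graph using (V; order)

-- A path is the list of its vertices in order, so its number of edges is one
-- less than the length of the list.
record IsPath (G : Graph) (u v : V G) (xs : List (V G)) : Set where
  constructor isPath
  field
    starts : head xs ≡ just u
    ends   : last xs ≡ just v
    linked : Linked (Graph.Adj G) xs
    unique : Unique xs

IsShortestPath : (G : Graph) → V G → V G → List (V G) → Set
IsShortestPath G u v xs =
  IsPath G u v xs × (∀ ys → IsPath G u v ys → length xs ≤ length ys)

Connected : Graph → Set
Connected G = ∀ u v → ∃ (IsPath G u v)

Dominating : (G : Graph) → Subset (order G) → Set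
Dominating G A = ∀ v → v ∈ A ⊎ ∃ λ u → u ∈ A × Graph.Adj G v u

Convex : (G : Graph) → Subset (order G) → Set
Convex G A = ∀ u v → u ∈ A → v ∈ A → ∀ xs → IsShortestPath G u v xs → All (_∈ A) xs

ConvexDominating : (G : Graph) → Subset (order G) → Set
ConvexDominating G A = Convex G A × Dominating G A

-- Searching lists of at most `order G` vertices suffices to decide convexity,
-- because the vertices of a path are distinct.

private
  lookup-All : ∀ {a p} {A : Set a} {P : Pred A p} {xs} →
               All P xs → ∀ i → P (lookup xs i)
  lookup-All (px ∷ _)  zero    = px
  lookup-All (_ ∷ pxs) (suc i) = lookup-All pxs i

  unique⇒lookup-injective : ∀ {a} {A : Set a} {xs : List A} →
                            Unique xs → Injective _≡_ _≡_ (lookup xs)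
  unique⇒lookup-injective (_ ∷ _)  {zero}  {zero}  _  = refl
  unique⇒lookup-injective (d ∷ _)  {zero}  {suc j} eq = ⊥-elim (lookup-All d j eq)
  unique⇒lookup-injective (d ∷ _)  {suc i} {zero}  eq = ⊥-elim (lookup-All d i (sym eq))
  unique⇒lookup-injective (_ ∷ un) {suc i} {suc j} eq = cong suc (unique⇒lookup-injective un eq)

length≤order : ∀ (G : Graph) {u v xs} → IsPath G u v xs → length xs ≤ order G
length≤order G p = injective⇒≤ (unique⇒lookup-injective (IsPath.unique p))

private
  anyList? : ∀ {n} k {P : Pred (List (Fin n)) 0ℓ} → Decidable P →
             Dec (∃ λ xs → length xs ≤ k × P xs)
  anyList? zero P? = map′ (λ p → [] , z≤n , p) (λ { ([] , _ , p) → p }) (P? [])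
  anyList? (suc k) P? =
    map′ (λ { (inj₁ p)                  → [] , z≤n , p
            ; (inj₂ (x , xs , le , p)) → x ∷ xs , s≤s le , p })
         (λ { ([]     , _      , p) → inj₁ p
            ; (x ∷ xs , s≤s le , p) → inj₂ (x , xs , le , p) })
         (P? [] ⊎-dec any? λ x → anyList? k (P? ∘ (x ∷_)))

  allPaths? : ∀ (G : Graph) {P Q : Pred (List (V G)) 0ℓ} → Decidable P → Decidable Q →
              (∀ {xs} → P xs → length xs ≤ order G) → Dec (∀ xs → P xs → Q xs)
  allPaths? G {P} {Q} P? Q? bound = map′ none⇒all all⇒none (¬? (anyList? (order G) bad?))
    where
    Bad : Pred (List (V G)) 0ℓ
    Bad xs = P xs × ¬ Q xs

    bad? : Decidable Bad
    bad? xs = P? xs ×-dec ¬? (Q? xs)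

    none⇒all : ¬ (∃ λ xs → length xs ≤ order G × Bad xs) → ∀ xs → P xs → Q xs
    none⇒all none xs p = decidable-stable (Q? xs) λ ¬q → none (xs , bound p , p , ¬q)

    all⇒none : (∀ xs → P xs → Q xs) → ¬ (∃ λ xs → length xs ≤ order G × Bad xs)
    all⇒none all (xs , _ , p , ¬q) = ¬q (all xs p)

isPath? : ∀ G u v → Decidable (IsPath G u v)
isPath? G u v xs =
  map′ (λ (s , e , l , un) → isPath s e l un)
       (λ (isPath s e l un) → s , e , l , un)
       (≡-dec _≟ᶠ_ (head xs) (just u) ×-dec ≡-dec _≟ᶠ_ (last xs) (just v)
         ×-dec linked? (Graph.adj? G) xs ×-dec unique? _≟ᶠ_ xs)

isShortestPath? : ∀ G u v → Decidable (IsShortestPath G u v)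
isShortestPath? G u v xs =
  isPath? G u v xs ×-dec
  allPaths? G (isPath? G u v) (λ ys → length xs ≤? length ys) (length≤order G)

dominating? : ∀ G → Decidable (Dominating G)
dominating? G A = all? λ v → v ∈? A ⊎-dec any? λ u → u ∈? A ×-dec Graph.adj? G v u

convex? : ∀ G → Decidable (Convex G)
convex? G A = all? λ u → all? λ v → (u ∈? A) →-dec ((v ∈? A) →-dec
  allPaths? G (isShortestPath? G u v) (All.all? (_∈? A)) (length≤order G ∘ proj₁))

convexDominating? : ∀ G → Decidable (ConvexDominating G)
convexDominating? G A = convex? G A ×-dec dominating? G A

IsMinimum : Pred ℕ 0ℓ → ℕ → Set
IsMinimum P k = P k × (∀ j → P j → k ≤ j)

least : ∀ {P : Pred ℕ 0ℓ} → Decidable P → ∀ m → P m → ∃ (IsMinimum P)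
least P? zero    p = zero , p , λ _ _ → z≤n
least P? (suc m) p with P? zero
... | yes p₀ = zero , p₀ , λ _ _ → z≤n
... | no ¬p₀ with least (P? ∘ suc) m p
...   | k , pk , min = suc k , pk , λ { zero    p₀ → ⊥-elim (¬p₀ p₀)
                                      ; (suc j) pj → s≤s (min j pj) }

ConvexDominatingSize : Graph → Pred ℕ 0ℓ
ConvexDominatingSize G k = ∃ λ A → ConvexDominating G A × ∣ A ∣ ≡ k

minConvexDominatingSize : ∀ G → ∃ (IsMinimum (ConvexDominatingSize G))
minConvexDominatingSize G =
  least (λ k → anySubset? λ A → convexDominating? G A ×-dec ∣ A ∣ ≟ⁿ k) (order G)
        (⊤ , ((λ _ _ _ _ xs _ → All.universal (λ _ → ∈⊤) xs) , λ _ → inj₁ ∈⊤) , ∣⊤∣≡n (order G))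

γcon : Graph → ℕ
γcon G = proj₁ (minConvexDominatingSize G)

module _ (G : Graph) (π : Permutation′ (order G)) where
  open Graph G using (Adj; adj?; symm; irrefl; nonEmpty)

  -- inj₁ v stands for v, and inj₂ v for its copy v′.
  PrismAdj : Rel (V G ⊎ V G) 0ℓ
  PrismAdj (inj₁ u) (inj₁ v) = Adj u v
  PrismAdj (inj₂ u) (inj₂ v) = Adj u v
  PrismAdj (inj₁ u) (inj₂ v) = v ≡ π ⟨$⟩ʳ u
  PrismAdj (inj₂ v) (inj₁ u) = v ≡ π ⟨$⟩ʳ u

  private
    prismAdj? : Decidable₂ PrismAdj
    prismAdj? (inj₁ u) (inj₁ v) = adj? u v
    prismAdj? (inj₂ u) (inj₂ v) = adj? u v
    prismAdj? (inj₁ u) (inj₂ v) = v ≟ᶠ π ⟨$⟩ʳ u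
    prismAdj? (inj₂ v) (inj₁ u) = v ≟ᶠ π ⟨$⟩ʳ u

    prismSymm : Symmetric PrismAdj
    prismSymm {inj₁ _} {inj₁ _} = symm
    prismSymm {inj₂ _} {inj₂ _} = symm
    prismSymm {inj₁ _} {inj₂ _} e = e
    prismSymm {inj₂ _} {inj₁ _} e = e

    prismIrrefl : Irreflexive _≡_ PrismAdj
    prismIrrefl {inj₁ _} refl = irrefl refl
    prismIrrefl {inj₂ _} refl = irrefl refl

    nonZero-+ : ∀ {m n} → NonZero m → NonZero (m + n)
    nonZero-+ {suc _} _ = _

  prism : Graph
  prism = record
    { order    = order G + order G
    ; nonEmpty = nonZero-+ nonEmpty
    ; Adj      = λ x y → PrismAdj (splitAt (order G) x) (splitAt (order G) y)
    ; adj?     = λ x y → prismAdj? (splitAt (order G) x) (splitAt (order G) y)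
    ; symm     = λ {x} {y} → prismSymm {splitAt (order G) x} {splitAt (order G) y}
    ; irrefl   = λ eq → prismIrrefl (cong (splitAt (order G)) eq)
    }

Id : Graph → Graph
Id G = prism G Perm.id

IsPrismFixer : Graph → Set
IsPrismFixer G = γcon (Id G) ≡ γcon G

IsPrismDoubler : Graph → Set
IsPrismDoubler G = γcon (Id G) ≡ 2 * γcon G

{-# OPTIONS --safe #-}
module Submission where

-- In Id G the distance of two vertices is the distance of their projections to G,
-- plus one if they lie in different copies. Hence V and, for every convex dominating
-- A of G, the set A ∪ A′ are convex dominating in Id G. Conversely, let B be convex
-- dominating in Id G. If B misses one copy, domination forces it to contain the other
-- one. Otherwise convexity puts the copy v′ of every v in B into B and vice versa, so
-- B = A ∪ A′ with A convex dominating in G. Therefore γcon (Id G) is the minimum of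
-- |V| and 2 γcon G; both equivalences are arithmetic, since γcon G > 0.

open import Data.Empty using (⊥-elim)
open import Data.Fin using (Fin; zero; suc; splitAt; join)
open import Data.Fin.Permutation as Perm using ()
open import Data.Fin.Properties using (splitAt-join; join-splitAt) renaming (_≟_ to _≟ᶠ_)
open import Data.Fin.Subset using (Subset; inside; outside; _∈_; _∉_; _⊆_; ∣_∣; ⊤; ⊥)
open import Data.Fin.Subset.Properties
  using (_∈?_; ∈⊤; ∣⁅x⁆∣≡1; x∈⁅y⁆⇒x≡y; ∉⊥; ∣⊤∣≡n; ∣⊥∣≡0; p⊆q⇒∣p∣≤∣q∣; nonempty?)
open import Data.List using (List; []; _∷_; head; last; length; map)
open import Data.List.Membership.Propositional using () renaming (_∈_ to _∈ˡ_)
open import Data.List.Membership.DecPropositional using () renaming (_∈?_ to ∈ˡ?)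
open import Data.List.Properties using (length-map)
open import Data.List.Relation.Unary.All as All using (All; []; _∷_)
open import Data.List.Relation.Unary.All.Properties using (¬Any⇒All¬; map⁻)
open import Data.List.Relation.Unary.AllPairs using ([]; _∷_)
open import Data.List.Relation.Unary.Any using (here; there)
open import Data.List.Relation.Unary.Linked using (Linked; [-]; _∷_)
open import Data.List.Relation.Unary.Unique.Propositional using (Unique)
open import Data.Maybe using (just)
open import Data.Nat using (ℕ; zero; suc; NonZero; _+_; _*_; _⊓_; _≤_; _<_; z≤n; s≤s)
open import Data.Nat.Properties
open import Data.Product using (∃; _×_; _,_; proj₁; proj₂)
open import Data.Sum using (_⊎_; inj₁; inj₂; [_,_]′)
open import Data.Vec as Vec using ([]; _∷_; _++_)
open import Data.Vec.Properties using (lookup-++ˡ; lookup-++ʳ; lookup⇒[]=; []=⇒lookup)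
open import Function using (id; _∘_)
open import Function.Bundles using (_⇔_; mk⇔)
open import Level using (0ℓ)
open import Relation.Binary using (Rel)
open import Relation.Binary.PropositionalEquality
  using (_≡_; refl; sym; trans; cong; cong₂; subst; subst₂)
open import Relation.Nullary using (¬_; yes; no)
open import Relation.Nullary.Decidable using (decidable-stable)
open import Relation.Unary using (Pred)
open import Defs

-- Walks and geodesics of an arbitrary relation.

private
  variable
    A B : Set
    R S : Rel A 0ℓ

-- Vertices may repeat, so walks can be projected, lifted and mapped without carrying a proof of
-- distinctness. The relation is arbitrary because prism vertices are also handled as `V ⊎ V`.
data Walk {A : Set} (R : Rel A 0ℓ) : A → A → List A → Set where
  nil  : ∀ {u} → Walk R u u (u ∷ [])
  cons : ∀ {u v w xs} → R u v → Walk R v w xs → Walk R u w (u ∷ xs)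

Geodesic : Rel A 0ℓ → A → A → List A → Set
Geodesic R u v xs = Walk R u v xs × (∀ {ys} → Walk R u v ys → length xs ≤ length ys)

GeodesicallyClosed : Rel A 0ℓ → Pred A 0ℓ → Set
GeodesicallyClosed R P = ∀ {u v xs} → P u → P v → Geodesic R u v xs → All P xs

Dominates : Rel A 0ℓ → Pred A 0ℓ → Set
Dominates R P = ∀ v → P v ⊎ ∃ λ u → P u × R v u

walk-map : (f : A → B) → (∀ {u v} → R u v → S (f u) (f v)) →
           ∀ {u v xs} → Walk R u v xs → Walk S (f u) (f v) (map f xs)
walk-map f hom nil        = nil
walk-map f hom (cons r w) = cons (hom r) (walk-map f hom w)

source∈ : ∀ {u v xs} → Walk R u v xs → u ∈ˡ xs
source∈ nil        = here refl
source∈ (cons _ _) = here refl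

-- Descent on length. The double negation avoids a search for a shortest walk and is harmless where
-- the goal is decidable, such as membership in a subset.
geodesic-exists : ∀ {u v xs} → Walk R u v xs → ¬ ¬ ∃ (Geodesic R u v)
geodesic-exists {R = R} {u} {v} {xs} w none = descend (suc (length xs)) w ≤-refl
  where
  descend : ∀ k {ys} → Walk R u v ys → ¬ length ys < k
  descend (suc k) {ys} w (s≤s len≤k) = none (ys , w , λ w′ →
    ≮⇒≥ λ shorter → descend k w′ (<-≤-trans shorter len≤k))

module _ (f : A → B) (g : B → A)
         (f-hom : ∀ u v → R u v → S (f u) (f v)) (g-hom : ∀ u v → S u v → R (g u) (g v))
         (g∘f : ∀ x → g (f x) ≡ x) (f∘g : ∀ y → f (g y) ≡ y)
         {P : Pred A 0ℓ} {Q : Pred B 0ℓ}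
         (from : ∀ x → Q (f x) → P x) (to : ∀ x → P x → Q (f x)) where

  -- The isomorphism `f` sends geodesics to geodesics, because a competing walk for `S` pulls back
  -- along `g` to a walk for `R` of equal length.
  closed-transport : GeodesicallyClosed S Q → GeodesicallyClosed R P
  closed-transport closed {u} {v} {xs} pu pv (w , min) =
    All.map (from _) (map⁻ (closed (to u pu) (to v pv) (walk-map f (f-hom _ _) w , λ {ys} w′ →
      subst₂ _≤_ (sym (length-map f xs)) (length-map g ys)
        (min (subst₂ (λ a b → Walk R a b (map g ys)) (g∘f u) (g∘f v) (walk-map g (g-hom _ _) w′))))))

  dominates-transport : Dominates S Q → Dominates R P
  dominates-transport dom v with dom (f v)
  ... | inj₁ q           = inj₁ (from v q)
  ... | inj₂ (y , q , r) = inj₂ (g y , from (g y) (subst Q (sym (f∘g y)) q) ,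
                                 subst (λ x → R x (g y)) (g∘f v) (g-hom _ _ r))

-- Loop removal, and shortest paths as geodesics.

module _ {n} {R : Rel (Fin n) 0ℓ} where

  suffix-from : ∀ {u v w xs} → Walk R v w xs → Unique xs → u ∈ˡ xs →
                ∃ λ ys → Walk R u w ys × Unique ys × length ys ≤ length xs
  suffix-from nil        un       (here refl) = _ , nil , un , ≤-refl
  suffix-from (cons r w) un       (here refl) = _ , cons r w , un , ≤-refl
  suffix-from (cons r w) (_ ∷ un) (there u∈)  with suffix-from w un u∈
  ... | ys , w′ , un′ , le = ys , w′ , un′ , m≤n⇒m≤1+n le

  -- If the new first vertex recurs, the loop up to its recurrence is cut off. The final alternative
  -- records that any change shortens strictly, which a geodesic does not allow.
  simplify : ∀ {u v xs} → Walk R u v xs →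
             ∃ λ ys → Walk R u v ys × Unique ys × (ys ≡ xs ⊎ length ys < length xs)
  simplify nil = _ , nil , ([] ∷ []) , inj₁ refl
  simplify {u} (cons r w) with simplify w
  ... | ys , w′ , un , shrink with ∈ˡ? _≟ᶠ_ u ys
  ...   | no u∉ = u ∷ ys , cons r w′ , ¬Any⇒All¬ ys u∉ ∷ un , [ inj₁ ∘ cong (u ∷_) , inj₂ ∘ s≤s ]′ shrink
  ...   | yes u∈ with suffix-from w′ un u∈
  ...     | zs , w″ , un′ , le =
    zs , w″ , un′ , inj₂ (s≤s (≤-trans le ([ ≤-reflexive ∘ cong length , <⇒≤ ]′ shrink)))

module _ (G : Graph) where
  open Graph G using (Adj)

  walk⇒path : ∀ {u v xs} → Walk Adj u v xs → Unique xs → IsPath G u v xs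
  walk⇒path w un = isPath (starts w) (ends w) (linked w) un
    where
    starts : ∀ {u v xs} → Walk Adj u v xs → head xs ≡ just u
    starts nil        = refl
    starts (cons _ _) = refl

    ends : ∀ {u v xs} → Walk Adj u v xs → last xs ≡ just v
    ends nil                   = refl
    ends (cons _ nil)          = refl
    ends (cons _ w@(cons _ _)) = ends w

    linked : ∀ {u v xs} → Walk Adj u v xs → Linked Adj xs
    linked nil                   = [-]
    linked (cons r nil)          = r ∷ [-]
    linked (cons r w@(cons _ _)) = r ∷ linked w

  path⇒walk : ∀ {u v xs} → IsPath G u v xs → Walk Adj u v xs
  path⇒walk (isPath starts ends linked _) = go starts ends linked
    where
    go : ∀ {u v xs} → head xs ≡ just u → last xs ≡ just v → Linked Adj xs → Walk Adj u v xs
    go refl refl [-]      = nil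
    go refl ends (r ∷ rs) = cons r (go refl ends rs)

  -- Loop removal turns a competing walk into a path that is no longer.
  shortest⇒geodesic : ∀ {u v xs} → IsShortestPath G u v xs → Geodesic Adj u v xs
  shortest⇒geodesic (p , min) = path⇒walk p , λ w →
    let ys , w′ , un , shrink = simplify w in
    ≤-trans (min ys (walk⇒path w′ un)) ([ ≤-reflexive ∘ cong length , <⇒≤ ]′ shrink)

  -- A strictly shorter simplification contradicts minimality, so the vertices of the walk are
  -- already distinct.
  geodesic⇒shortest : ∀ {u v xs} → Geodesic Adj u v xs → IsShortestPath G u v xs
  geodesic⇒shortest (w , min) with simplify w
  ... | _ , w′ , un , inj₁ refl    = walk⇒path w′ un , λ _ p → min (path⇒walk p)
  ... | _ , w′ , _  , inj₂ shorter = ⊥-elim (<⇒≱ shorter (min w′))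

  convex⇒closed : ∀ {A} → Convex G A → GeodesicallyClosed Adj (_∈ A)
  convex⇒closed convex u∈ v∈ geo = convex _ _ u∈ v∈ _ (geodesic⇒shortest geo)

  closed⇒convex : ∀ {A} → GeodesicallyClosed Adj (_∈ A) → Convex G A
  closed⇒convex closed _ _ u∈ v∈ _ sp = closed u∈ v∈ (shortest⇒geodesic sp)

-- Subsets of a disjoint union, and cardinalities.

∣p++q∣≡∣p∣+∣q∣ : ∀ {m n} (P : Subset m) (Q : Subset n) → ∣ P ++ Q ∣ ≡ ∣ P ∣ + ∣ Q ∣
∣p++q∣≡∣p∣+∣q∣ []            Q = refl
∣p++q∣≡∣p∣+∣q∣ (inside  ∷ P) Q = cong suc (∣p++q∣≡∣p∣+∣q∣ P Q)
∣p++q∣≡∣p∣+∣q∣ (outside ∷ P) Q = ∣p++q∣≡∣p∣+∣q∣ P Q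

∣p++p∣≡2*∣p∣ : ∀ {n} (P : Subset n) → ∣ P ++ P ∣ ≡ 2 * ∣ P ∣
∣p++p∣≡2*∣p∣ P = trans (∣p++q∣≡∣p∣+∣q∣ P P) (cong (∣ P ∣ +_) (sym (+-identityʳ ∣ P ∣)))

module _ {m n} (P : Subset m) (Q : Subset n) where

  In : Pred (Fin m ⊎ Fin n) 0ℓ
  In = [ _∈ P , _∈ Q ]′

  join∈⁺ : ∀ s → In s → join m n s ∈ P ++ Q
  join∈⁺ (inj₁ i) i∈ = lookup⇒[]= _ _ (trans (lookup-++ˡ P Q i) ([]=⇒lookup i∈))
  join∈⁺ (inj₂ j) j∈ = lookup⇒[]= _ _ (trans (lookup-++ʳ P Q j) ([]=⇒lookup j∈))

  join∈⁻ : ∀ s → join m n s ∈ P ++ Q → In s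
  join∈⁻ (inj₁ i) i∈ = lookup⇒[]= _ _ (trans (sym (lookup-++ˡ P Q i)) ([]=⇒lookup i∈))
  join∈⁻ (inj₂ j) j∈ = lookup⇒[]= _ _ (trans (sym (lookup-++ʳ P Q j)) ([]=⇒lookup j∈))

convexDominating-nonempty : ∀ G {A} → ConvexDominating G A → 0 < ∣ A ∣
convexDominating-nonempty G {A} (_ , dom) =
  [ member , (λ (_ , u∈ , _) → member u∈) ]′ (dom (inhabitant (Graph.nonEmpty G)))
  where
  inhabitant : ∀ {n} → NonZero n → Fin n
  inhabitant {suc _} _ = zero

  member : ∀ {x} → x ∈ A → 0 < ∣ A ∣
  member {x} x∈ = subst (_≤ ∣ A ∣) (∣⁅x⁆∣≡1 x)
    (p⊆q⇒∣p∣≤∣q∣ λ y∈ → subst (_∈ A) (sym (x∈⁅y⁆⇒x≡y x y∈)) x∈)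

-- Distances and geodesics in `Id G`.

module _ (G : Graph) where
  open Graph G using (V; Adj; order)

  Vertex : Set
  Vertex = V ⊎ V

  _~_ : Rel Vertex 0ℓ
  _~_ = PrismAdj G Perm.id

  base : Vertex → V
  base = [ id , id ]′

  -- The distance in Id G exceeds the distance of the projections by exactly this amount.
  gap : Vertex → Vertex → ℕ
  gap (inj₁ _) (inj₁ _) = 0
  gap (inj₂ _) (inj₂ _) = 0
  gap (inj₁ _) (inj₂ _) = 1
  gap (inj₂ _) (inj₁ _) = 1

  gap-refl : ∀ s → gap s s ≡ 0
  gap-refl (inj₁ _) = refl
  gap-refl (inj₂ _) = refl

  -- An edge inside a copy leaves every `gap` unchanged; a crossing edge fixes the projection and
  -- changes a `gap` by at most one, of which only the upper bound is kept.
  data Step (s t : Vertex) : Set where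
    along  : Adj (base s) (base t) → (∀ r → gap s r ≡ gap t r) → Step s t
    across : base s ≡ base t → (∀ r → gap s r ≤ suc (gap t r)) → Step s t

  step : ∀ s t → s ~ t → Step s t
  step (inj₁ _) (inj₁ _) r = along r λ { (inj₁ _) → refl ; (inj₂ _) → refl }
  step (inj₂ _) (inj₂ _) r = along r λ { (inj₁ _) → refl ; (inj₂ _) → refl }
  step (inj₁ _) (inj₂ _) e = across (sym e) λ { (inj₁ _) → z≤n ; (inj₂ _) → s≤s z≤n }
  step (inj₂ _) (inj₁ _) e = across e λ { (inj₁ _) → s≤s z≤n ; (inj₂ _) → z≤n }

  -- Invariant of the projection that drops crossing edges. `bound` gives the lower bound on
  -- distances, `covers` the convexity of a doubled set, and `sameSide` the convexity of a single
  -- copy.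
  record Projection (s t : Vertex) (xs : List Vertex) : Set where
    field
      {vertices} : List V
      walk       : Walk Adj (base s) (base t) vertices
      bound      : length vertices + gap s t ≤ length xs
      covers     : All (λ x → base x ∈ˡ vertices) xs
      sameSide   : All (λ x → gap s x ≡ 0) xs ⊎ length vertices < length xs

  project : ∀ {s t xs} → Walk _~_ s t xs → Projection s t xs
  project {s} nil = record
    { walk = nil ; bound = s≤s (≤-reflexive (gap-refl s)) ; covers = here refl ∷ []
    ; sameSide = inj₁ (gap-refl s ∷ []) }
  project {s} {t} (cons {v = s′} r w) with project w | step s s′ r
  ... | p | along a same = record
    { walk     = cons a P.walk
    ; bound    = s≤s (subst (λ k → length P.vertices + k ≤ _) (sym (same t)) P.bound)
    ; covers   = here refl ∷ All.map there P.covers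
    ; sameSide = [ (λ all → inj₁ (gap-refl s ∷ All.map (trans (same _)) all)) , inj₂ ∘ s≤s ]′ P.sameSide
    } where module P = Projection p
  ... | p | across e close = record
    { walk     = subst (λ v → Walk Adj v (base t) P.vertices) (sym e) P.walk
    -- The crossing edge adds a vertex to the walk and none to its projection, which pays for the
    -- growth of `gap` by one.
    ; bound    = ≤-trans (+-monoʳ-≤ (length P.vertices) (close t))
                   (≤-trans (≤-reflexive (+-suc (length P.vertices) (gap s′ t))) (s≤s P.bound))
    ; covers   = subst (_∈ˡ P.vertices) (sym e) (source∈ P.walk) ∷ P.covers
    ; sameSide = inj₂ (s≤s (≤-trans (m≤m+n (length P.vertices) (gap s′ t)) P.bound))
    } where module P = Projection p

  -- Between different copies, cross first and then follow the given walk in the target copy. With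
  -- `length-lower-bound` this makes the distance formula exact.
  lift : ∀ s t {ys} → Walk Adj (base s) (base t) ys →
         ∃ λ xs → Walk _~_ s t xs × length xs ≡ gap s t + length ys
  lift (inj₁ _) (inj₁ _) {ys} w = _ , walk-map inj₁ id w , length-map inj₁ ys
  lift (inj₂ _) (inj₂ _) {ys} w = _ , walk-map inj₂ id w , length-map inj₂ ys
  lift (inj₁ u) (inj₂ _) {ys} w = _ , cons refl (walk-map inj₂ id w) , cong suc (length-map inj₂ ys)
  lift (inj₂ u) (inj₁ _) {ys} w = _ , cons refl (walk-map inj₁ id w) , cong suc (length-map inj₁ ys)

  length-lower-bound : ∀ {s t xs ys} → Geodesic Adj (base s) (base t) ys → Walk _~_ s t xs →
                       gap s t + length ys ≤ length xs
  length-lower-bound {s} {t} {ys = ys} (_ , min) w =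
    ≤-trans (+-monoʳ-≤ (gap s t) (min P.walk))
      (≤-trans (≤-reflexive (+-comm (gap s t) (length P.vertices))) P.bound)
    where module P = Projection (project w)

  -- A shorter walk between the projections would lift, at the same cost `gap s t`, to a walk
  -- shorter than `xs`.
  projection-geodesic : ∀ {s t xs} → Geodesic _~_ s t xs →
                        ∃ λ ys → Geodesic Adj (base s) (base t) ys × All (λ x → base x ∈ˡ ys) xs
  projection-geodesic {s} {t} (w , min) = _ , (P.walk , shortest) , P.covers
    where
    module P = Projection (project w)
    shortest : ∀ {zs} → Walk Adj (base s) (base t) zs → length P.vertices ≤ length zs
    shortest {zs} w′ with lift s t w′
    ... | _ , w″ , len = +-cancelʳ-≤ (gap s t) _ _
      (≤-trans P.bound (≤-trans (min w″) (≤-reflexive (trans len (+-comm (gap s t) (length zs))))))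

  -- A geodesic leaving its copy has a strictly shorter projection, which lifts without an extra
  -- vertex as the ends share a copy.
  geodesic-sameSide : ∀ {s t xs} → gap s t ≡ 0 → Geodesic _~_ s t xs → All (λ x → gap s x ≡ 0) xs
  geodesic-sameSide {s} {t} {xs} same (w , min) with project w
  ... | p with Projection.sameSide p
  ...   | inj₁ all     = all
  ...   | inj₂ shorter with lift s t (Projection.walk p)
  ...     | _ , w′ , len = ⊥-elim (<⇒≱ shorter
    (≤-trans (min w′) (≤-reflexive (trans len (cong (_+ _) same)))))

  -- Every vertex of a geodesic lies over a geodesic of `G`, which stays in `A`.
  closed-double : ∀ {A} → GeodesicallyClosed Adj (_∈ A) → GeodesicallyClosed _~_ (In A A)
  closed-double {A} closed {s} {t} s∈ t∈ geo with projection-geodesic geo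
  ... | ys , geo′ , covers =
    All.map (λ {x} x∈ → to x (All.lookup (closed (from s s∈) (from t t∈) geo′) x∈)) covers
    where
    from : ∀ s → In A A s → base s ∈ A
    from (inj₁ _) = id
    from (inj₂ _) = id
    to : ∀ s → base s ∈ A → In A A s
    to (inj₁ _) = id
    to (inj₂ _) = id

  dominates-double : ∀ {A} → Dominates Adj (_∈ A) → Dominates _~_ (In A A)
  dominates-double dom (inj₁ v) = [ inj₁ , (λ (u , u∈ , r) → inj₂ (inj₁ u , u∈ , r)) ]′ (dom v)
  dominates-double dom (inj₂ v) = [ inj₁ , (λ (u , u∈ , r) → inj₂ (inj₂ u , u∈ , r)) ]′ (dom v)

  closed-side : GeodesicallyClosed _~_ (In ⊤ ⊥)
  closed-side {inj₂ _} s∈ _  _ = ⊥-elim (∉⊥ s∈)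
  closed-side {_} {inj₂ _} _ t∈ _ = ⊥-elim (∉⊥ t∈)
  closed-side {inj₁ _} {inj₁ _} _ _ geo =
    All.map (λ {x} → left x) (geodesic-sameSide refl geo)
    where
    left : ∀ {u} x → gap (inj₁ u) x ≡ 0 → In ⊤ ⊥ x
    left (inj₁ _) _ = ∈⊤

  dominates-side : Dominates _~_ (In ⊤ ⊥)
  dominates-side (inj₁ _) = inj₁ ∈⊤
  dominates-side (inj₂ v) = inj₂ (inj₁ v , ∈⊤ , refl)

  -- Transfer between `V ⊎ V` and the vertices of `Id G`.

  module _ (P Q : Subset order) where

    splitAt∈⁺ : ∀ x → x ∈ P ++ Q → In P Q (splitAt order x)
    splitAt∈⁺ x x∈ =
      join∈⁻ P Q (splitAt order x) (subst (_∈ P ++ Q) (sym (join-splitAt order order x)) x∈)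

    splitAt∈⁻ : ∀ x → In P Q (splitAt order x) → x ∈ P ++ Q
    splitAt∈⁻ x x∈ =
      subst (_∈ P ++ Q) (join-splitAt order order x) (join∈⁺ P Q (splitAt order x) x∈)

    join-hom : ∀ s t → s ~ t → Graph.Adj (Id G) (join order order s) (join order order t)
    join-hom s t =
      subst₂ _~_ (sym (splitAt-join order order s)) (sym (splitAt-join order order t))

    id-convexDominating⁺ : GeodesicallyClosed _~_ (In P Q) → Dominates _~_ (In P Q) →
                           ConvexDominating (Id G) (P ++ Q)
    id-convexDominating⁺ closed dom =
      closed⇒convex (Id G)
        -- Adjacency in `Id G` is by definition `_~_` after `splitAt`, so the identity function
        -- shows that `splitAt` preserves it.
        (closed-transport {S = _~_} (splitAt order) (join order order) (λ _ _ r → r) join-hom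
          (join-splitAt order order) (splitAt-join order order) splitAt∈⁻ splitAt∈⁺ closed) ,
      dominates-transport {S = _~_} (splitAt order) (join order order) (λ _ _ r → r) join-hom
        (join-splitAt order order) (splitAt-join order order) splitAt∈⁻ splitAt∈⁺ dom

    id-convexDominating⁻ : ConvexDominating (Id G) (P ++ Q) →
                           GeodesicallyClosed _~_ (In P Q) × Dominates _~_ (In P Q)
    id-convexDominating⁻ (convex , dom) =
      closed-transport {R = _~_} (join order order) (splitAt order) join-hom (λ _ _ r → r)
        (splitAt-join order order) (join-splitAt order order) (join∈⁻ P Q) (join∈⁺ P Q)
        (convex⇒closed (Id G) convex) ,
      dominates-transport {R = _~_} (join order order) (splitAt order) join-hom (λ _ _ r → r)
        (splitAt-join order order) (join-splitAt order order) (join∈⁻ P Q) (join∈⁺ P Q) dom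

  -- The shape of convex dominating sets of `Id G`.

  -- A geodesic between the two copies may cross over in its first step.
  closed-cross : Connected G → ∀ {C : Pred Vertex 0ℓ} → GeodesicallyClosed _~_ C →
                 (f g : V → Vertex) → (∀ v → base (f v) ≡ v) → (∀ v → base (g v) ≡ v) →
                 (∀ {u v} → Adj u v → g u ~ g v) →
                 (∀ v → f v ~ g v) → (∀ u v → gap (f u) (g v) ≡ 1) →
                 ∀ {u v} → C (f u) → C (g v) → ¬ ¬ C (g u)
  closed-cross conn closed f g bf bg g-hom fg far {u} {v} fu∈ gv∈ gu∉ =
    geodesic-exists (path⇒walk G (proj₂ (conn u v))) λ (ys , geo) →
      let w = walk-map g g-hom (proj₁ geo) in
      gu∉ (All.lookup (closed fu∈ gv∈ (cons (fg u) w , λ {zs} w′ →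
             subst₂ (λ a b → a + b ≤ length zs) (far u v) (sym (length-map g ys))
               (length-lower-bound
                 (subst₂ (λ a b → Geodesic Adj a b ys) (sym (bf u)) (sym (bg v)) geo) w′)))
           (there (source∈ w)))

  module _ (conn : Connected G) {P Q : Subset order}
           (closed : GeodesicallyClosed _~_ (In P Q)) (dom : Dominates _~_ (In P Q)) where

    -- Crossing at `u` starts a geodesic to the copy of `v`, so convexity yields the copy of `u`;
    -- `v` only witnesses that the second copy is met.
    left⊆right : ∀ {v} → v ∈ Q → P ⊆ Q
    left⊆right v∈ {u} u∈ = decidable-stable (u ∈? Q)
      (closed-cross conn closed inj₁ inj₂ (λ _ → refl) (λ _ → refl) id (λ _ → refl) (λ _ _ → refl) u∈ v∈)

    right⊆left : ∀ {v} → v ∈ P → Q ⊆ P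
    right⊆left v∈ {u} u∈ = decidable-stable (u ∈? P)
      (closed-cross conn closed inj₂ inj₁ (λ _ → refl) (λ _ → refl) id (λ _ → refl) (λ _ _ → refl) u∈ v∈)

    -- The only neighbour of a copied vertex in the first copy is its original, which must therefore
    -- dominate it.
    left-full : (∀ {v} → v ∉ Q) → ⊤ ⊆ P
    left-full empty {v} _ with dom (inj₂ v)
    ... | inj₁ v∈                = ⊥-elim (empty v∈)
    ... | inj₂ (inj₁ u , u∈ , e) = subst (_∈ P) (sym e) u∈
    ... | inj₂ (inj₂ u , u∈ , _) = ⊥-elim (empty u∈)

    right-full : (∀ {v} → v ∉ P) → ⊤ ⊆ Q
    right-full empty {v} _ with dom (inj₁ v)
    ... | inj₁ v∈                = ⊥-elim (empty v∈)
    ... | inj₂ (inj₂ u , u∈ , e) = subst (_∈ Q) e u∈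
    ... | inj₂ (inj₁ u , u∈ , _) = ⊥-elim (empty u∈)

    -- A geodesic of `G` remains one inside the first copy, where `gap` is zero. A vertex dominated
    -- by its own copy lies in `P` because `Q ⊆ P`.
    left-convexDominating : Q ⊆ P → ConvexDominating G P
    left-convexDominating Q⊆P = closed⇒convex G closed-left , dominates-left
      where
      closed-left : GeodesicallyClosed Adj (_∈ P)
      closed-left {xs = xs} u∈ v∈ geo = map⁻ (closed u∈ v∈ (walk-map inj₁ id (proj₁ geo) ,
        λ {zs} w → subst (_≤ length zs) (sym (length-map inj₁ xs)) (length-lower-bound geo w)))

      dominates-left : Dominating G P
      dominates-left v with dom (inj₁ v)
      ... | inj₁ v∈                = inj₁ v∈
      ... | inj₂ (inj₁ u , u∈ , r) = inj₂ (u , u∈ , r)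
      ... | inj₂ (inj₂ u , u∈ , e) = inj₁ (Q⊆P (subst (_∈ Q) e u∈))

    size-lower-bound : ∀ {g} → IsMinimum (ConvexDominatingSize G) g →
                       order ⊓ (2 * g) ≤ ∣ P ∣ + ∣ Q ∣
    size-lower-bound {g} (_ , min) with nonempty? P | nonempty? Q
    ... | no empty | _ = ≤-trans (m⊓n≤m _ _) (≤-trans
      (subst (_≤ ∣ Q ∣) (∣⊤∣≡n order) (p⊆q⇒∣p∣≤∣q∣ (right-full λ v∈ → empty (_ , v∈)))) (m≤n+m _ ∣ P ∣))
    ... | yes _ | no empty = ≤-trans (m⊓n≤m _ _) (≤-trans
      (subst (_≤ ∣ P ∣) (∣⊤∣≡n order) (p⊆q⇒∣p∣≤∣q∣ (left-full λ v∈ → empty (_ , v∈)))) (m≤m+n _ ∣ Q ∣))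
    ... | yes (_ , p∈) | yes (_ , q∈) =
      -- Only `P` is shown convex dominating; `Q` inherits the bound from `P ⊆ Q`. The product
      -- `2 * g` unfolds to `g + (g + 0)`.
      ≤-trans (m⊓n≤n order _) (+-mono-≤ g≤P (subst (_≤ ∣ Q ∣) (sym (+-identityʳ _))
        (≤-trans g≤P (p⊆q⇒∣p∣≤∣q∣ (left⊆right q∈)))))
      where
      g≤P : g ≤ ∣ P ∣
      g≤P = min _ (P , left-convexDominating (right⊆left p∈) , refl)

  -- The value of `γcon (Id G)`.

  -- The two minima are variables because γcon would be unfolded during unification.
  module _ {g k} (g-min : IsMinimum (ConvexDominatingSize G) g)
                 (k-min : IsMinimum (ConvexDominatingSize (Id G)) k) where

    id-size≤order : k ≤ order
    id-size≤order =
      proj₂ k-min _ (⊤ {order} ++ ⊥ {order} , id-convexDominating⁺ ⊤ ⊥ closed-side dominates-side , size)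
      where
      size : ∣ ⊤ {order} ++ ⊥ {order} ∣ ≡ order
      size = trans (∣p++q∣≡∣p∣+∣q∣ (⊤ {order}) (⊥ {order}))
        (trans (cong₂ _+_ (∣⊤∣≡n order) (∣⊥∣≡0 order)) (+-identityʳ order))

    id-size≤double : k ≤ 2 * g
    id-size≤double with proj₁ g-min
    ... | A , (convex , dom) , size = proj₂ k-min _
      (A ++ A ,
       id-convexDominating⁺ A A (closed-double (convex⇒closed G convex)) (dominates-double dom) ,
       trans (∣p++p∣≡2*∣p∣ A) (cong (2 *_) size))

    id-size : Connected G → k ≡ order ⊓ (2 * g)
    id-size conn = ≤-antisym (⊓-glb id-size≤order id-size≤double) lower
      where
      lower : order ⊓ (2 * g) ≤ k
      lower with proj₁ k-min
      ... | C , cd , size with Vec.splitAt order C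
      ...   | P , Q , refl =
        let closed , dom = id-convexDominating⁻ P Q cd in
        subst (order ⊓ (2 * g) ≤_) (trans (sym (∣p++q∣≡∣p∣+∣q∣ P Q)) size)
          (size-lower-bound conn {P} {Q} closed dom g-min)

-- Arithmetic of the minimum.

module _ {n g k : ℕ} (k≡min : k ≡ n ⊓ (2 * g)) where

  -- Positivity gives `g < 2 * g`, so the minimum can equal `g` only by being `n`.
  min-fixed⇔ : 0 < g → (k ≡ g) ⇔ (g ≡ n)
  min-fixed⇔ 0<g = mk⇔ to from
    where
    g<2g : g < 2 * g
    g<2g = m<m+n g (subst (0 <_) (sym (+-identityʳ g)) 0<g)

    to : k ≡ g → g ≡ n
    to k≡g with ⊓-sel n (2 * g)
    ... | inj₁ min≡n  = trans (sym k≡g) (trans k≡min min≡n)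
    ... | inj₂ min≡2g = ⊥-elim (<⇒≢ g<2g (trans (sym k≡g) (trans k≡min min≡2g)))

    from : g ≡ n → k ≡ g
    from g≡n = trans k≡min
      (trans (m≤n⇒m⊓n≡m (subst (_≤ 2 * g) g≡n (<⇒≤ g<2g))) (sym g≡n))

  min-doubled⇔ : (k ≡ 2 * g) ⇔ (2 * g ≤ n)
  min-doubled⇔ = mk⇔ (λ k≡2g → m⊓n≡n⇒n≤m (trans (sym k≡min) k≡2g))
                     (λ 2g≤n → trans k≡min (m≥n⇒m⊓n≡n 2g≤n))

corollary16 : (G : Graph) → Connected G →
    (IsPrismFixer G ⇔ (γcon G ≡ Graph.order G)) ×
    (IsPrismDoubler G ⇔ (2 * γcon G ≤ Graph.order G))
corollary16 G conn = min-fixed⇔ formula positive , min-doubled⇔ {g = γcon G} formula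
  where
  formula : γcon (Id G) ≡ Graph.order G ⊓ (2 * γcon G)
  formula = id-size G (proj₂ (minConvexDominatingSize G)) (proj₂ (minConvexDominatingSize (Id G))) conn

  positive : 0 < γcon G
  positive with proj₁ (proj₂ (minConvexDominatingSize G))
  ... | A , cd , size = subst (0 <_) size (convexDominating-nonempty G cd)
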